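{- For $n\ge 0$, $$(\mathfrak C_0+\mathfrak C_0)^n=(2n)!\sum_{l=0}^{n}\frac{(-1)^{n-l}(2n-2l-3)!!\,(2l-1)}{2^{n-l}(n-l)!\,(2l)!}\mathfrak C_{2l}.$$
   Context: The numbers $\mathfrak C_{2n}$ (Cauchy numbers with level $2$) are defined by $\frac{t}{{\rm arcsinh}\,t}=\sum_{n=0}^\infty\mathfrak C_{2n}\frac{t^{2n}}{(2n)!}$ (equivalently $\mathfrak C_{2n}=\mathfrak C_{2n}^{(1)}$, where ${\rm Lif}_{2,1}({\rm arcsinh}\,t)=\sum_n\mathfrak C_n^{(1)}t^n/n!$ with ${\rm Lif}_{2,1}(z)=\sum_{m\ge0}\frac{z^{2m}}{(2m+1)!}$). Convolution notation: $(\mathfrak C_{2j_1}+\cdots+\mathfrak C_{2j_k})^n:=\sum_{i_1+\cdots+i_k=n,\ i_1,\dots,i_k\ge0}\frac{(2n)!}{(2i_1)!\cdots(2i_k)!}\mathfrak C_{2i_1+2j_1}\cdots\mathfrak C_{2i_k+2j_k}$. Double factorials: $(2i-1)!!=(2i-1)(2i-3)\cdots1$ for $i\ge1$, $(-1)!!=1$, and $(-(2i+1))!!=\frac{(-1)^i}{(2i-1)!!}$ for $i\ge1$. -}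

module Defs where

open import Data.Integer as ℤ using (ℤ; +_; -[1+_]; -1ℤ)
open import Data.Nat as ℕ using (ℕ; zero; suc; _∸_; _!; ⌊_/2⌋)
open import Data.Product using (∃-syntax; _×_)
open import Data.Rational using (ℚ; 0ℚ; 1ℚ; _+_; _*_; _/_)
open import Data.Vec using (Vec; []; _∷_)
open import Relation.Binary.PropositionalEquality using (_≡_)

infixl 7 _÷_
infix 8 _!!

fromℤ : ℤ → ℚ
fromℤ z = z / 1

fromℕ : ℕ → ℚ
fromℕ n = fromℤ (+ n)

-- Every divisor below is a product of powers of 2, factorials and double
-- factorials, so the value at 0 is never used.
_÷_ : ℚ → ℕ → ℚ
p ÷ zero  = 0ℚ
p ÷ suc d = p * (+ 1 / suc d)

∑≤ : ℕ → (ℕ → ℚ) → ℚ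
∑≤ zero    f = f 0
∑≤ (suc n) f = ∑≤ n f + f (suc n)

infix 5 ∑≤
syntax ∑≤ n (λ i → x) = ∑[ i ≤ n ] x

-- The sum of f over all (i₁ , … , iₖ) with i₁ + ⋯ + iₖ = n.
∑Compositions : (k n : ℕ) → (Vec ℕ k → ℚ) → ℚ
∑Compositions zero    zero    f = f []
∑Compositions zero    (suc _) f = 0ℚ
∑Compositions (suc k) n       f =
  ∑[ i ≤ n ] ∑Compositions k (n ∸ i) (λ is → f (i ∷ is))

-- Formal power series over ℚ: f n is the coefficient of tⁿ.

Series : Set
Series = ℕ → ℚ

infix 4 _≈_
infixl 7 _·_
infixr 8 _^_
infixr 9 _∘_

_≈_ : Series → Series → Set
f ≈ g = ∀ n → f n ≡ g n

𝟙 : Series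
𝟙 zero    = 1ℚ
𝟙 (suc _) = 0ℚ

t·_ : Series → Series
(t· f) zero    = 0ℚ
(t· f) (suc n) = f n

t : Series
t = t· 𝟙

_·_ : Series → Series → Series
(f · g) n = ∑[ i ≤ n ] f i * g (n ∸ i)

_^_ : Series → ℕ → Series
f ^ zero  = 𝟙
f ^ suc k = f · f ^ k

-- f ∘ g is f(g(t)) provided g has zero constant term: then gᵏ contributes
-- nothing to the coefficient of tⁿ for k > n.
_∘_ : Series → Series → Series
(f ∘ g) n = ∑[ k ≤ n ] f k * (g ^ k) n

-- ∑ₙ aₙ t²ⁿ
even : (ℕ → ℚ) → Series
even a zero          = a 0
even a (suc zero)    = 0ℚ
even a (suc (suc n)) = even (λ k → a (suc k)) n

-- ∑ₙ t²ⁿ⁺¹ / (2n+1)!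
sinh : Series
sinh = t· even (λ n → 1ℚ ÷ (2 ℕ.* n ℕ.+ 1) !)

-- The compositional inverse of sinh; it exists and is unique because
-- sinh t = t + O(t³).
IsArcsinh : Series → Set
IsArcsinh a = a 0 ≡ 0ℚ × sinh ∘ a ≈ t

-- Here c n stands for the Cauchy number with level 2 of index 2n.  The defining
-- equation t / arcsinh t = ∑ₙ c n t²ⁿ / (2n)! is multiplied out; this determines
-- c, since ℚ[[t]] is an integral domain.
IsCauchyLevel2 : (ℕ → ℚ) → Set
IsCauchyLevel2 c =
  ∃[ arcsinh ] IsArcsinh arcsinh
             × even (λ n → c n ÷ (2 ℕ.* n) !) · arcsinh ≈ t

∏[2_]! : ∀ {k} → Vec ℕ k → ℕ
∏[2 [] ]!     = 1
∏[2 i ∷ is ]! = (2 ℕ.* i) ! ℕ.* ∏[2 is ]!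

∏-shifted : (ℕ → ℚ) → ∀ {k} → Vec ℕ k → Vec ℕ k → ℚ
∏-shifted c []       []       = 1ℚ
∏-shifted c (j ∷ js) (i ∷ is) = c (i ℕ.+ j) * ∏-shifted c js is

-- (C₂ⱼ₁ + ⋯ + C₂ⱼₖ)ⁿ in umbral notation, where js = (j₁ , … , jₖ) and C₂ⱼ = c j.
convolution : (ℕ → ℚ) → ∀ {k} → Vec ℕ k → ℕ → ℚ
convolution c {k} js n =
  ∑Compositions k n λ is → (fromℕ ((2 ℕ.* n) !) ÷ ∏[2 is ]!) * ∏-shifted c js is

_‼ : ℕ → ℕ
zero          ‼ = 1
suc zero      ‼ = 1
suc (suc n)   ‼ = suc (suc n) ℕ.* n ‼

-- Double factorial extended to negative odd integers: with m = 2i the second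
-- clause is (-(2i+1))!! = (-1)ⁱ / (2i-1)!!, and i = 0 gives (-1)!! = 1 because
-- 0 ∸ 1 = 0.  The values at negative even integers are meaningless.
_!! : ℤ → ℚ
(+ n)    !! = fromℕ (n ‼)
-[1+ m ] !! = fromℤ (-1ℤ ℤ.^ ⌊ m /2⌋) ÷ (m ∸ 1) ‼

{-# OPTIONS --safe #-}
-- Write f = t / arcsinh t, a = arcsinh t, C = cosh a and θ = t d/dt.  From
-- f a = t and C θa = t one gets f² = C (f - θf).  Moreover θC = t θa, whence
-- θ(C²) = 2t² and C² = 1 + t²; thus (1 + t²) θC = t² C, which determines the
-- coefficients of C = √(1 + t²).  The theorem compares coefficients of t²ⁿ in
-- f² + C θf = C f.
module Submission where

open import Defs
open import Algebra.Bundles using (CommutativeSemiring)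
import Algebra.Solver.Ring.NaturalCoefficients.Default as SemiringSolver
import Algebra.Structures.Biased as Biased
open import Data.Integer as ℤ using (+_; -1ℤ)
import Data.Integer.Properties as ℤ
open import Data.Nat as ℕ using (ℕ; zero; suc; _∸_; _!; z≤n; s≤s)
import Data.Nat.Properties as ℕ
open import Data.Product using (_,_)
open import Data.Rational using (ℚ; 0ℚ; 1ℚ; _+_; _*_; -_; _/_; toℚᵘ; fromℚᵘ)
open import Data.Rational.Properties
import Data.Rational.Solver as ℚ
open import Data.Rational.Unnormalised as ℚᵘ using (mkℚᵘ; *≡*)
import Data.Rational.Unnormalised.Properties as ℚᵘ
open import Data.Vec using (Vec; []; _∷_)
open import Level using (0ℓ)
open import Relation.Binary.PropositionalEquality
import Relation.Binary.Reasoning.Setoid as SetoidReasoning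
open import Relation.Binary.Structures using (IsEquivalence)

open ℚ.+-*-Solver

infixl 6 _⊕_

-- Integers and reciprocals inside the rationals

-- `_/_` normalises by the gcd, so identities between fractions with variable entries do not hold by
-- computation. They are proved for unnormalised fractions and carried over along `fromℚᵘ`, since
-- `i / suc d` unfolds to `fromℚᵘ (mkℚᵘ i d)`.
fromℚᵘ-homo-+ : ∀ p q → fromℚᵘ (p ℚᵘ.+ q) ≡ fromℚᵘ p + fromℚᵘ q
fromℚᵘ-homo-+ p q = toℚᵘ-injective (begin
  toℚᵘ (fromℚᵘ (p ℚᵘ.+ q))               ≈⟨ toℚᵘ-fromℚᵘ (p ℚᵘ.+ q) ⟩
  p ℚᵘ.+ q                               ≈⟨ ℚᵘ.+-cong (toℚᵘ-fromℚᵘ p) (toℚᵘ-fromℚᵘ q) ⟨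
  toℚᵘ (fromℚᵘ p) ℚᵘ.+ toℚᵘ (fromℚᵘ q)   ≈⟨ toℚᵘ-homo-+ (fromℚᵘ p) (fromℚᵘ q) ⟨
  toℚᵘ (fromℚᵘ p + fromℚᵘ q)             ∎)
  where open SetoidReasoning ℚᵘ.≃-setoid

fromℚᵘ-homo-* : ∀ p q → fromℚᵘ (p ℚᵘ.* q) ≡ fromℚᵘ p * fromℚᵘ q
fromℚᵘ-homo-* p q = toℚᵘ-injective (begin
  toℚᵘ (fromℚᵘ (p ℚᵘ.* q))               ≈⟨ toℚᵘ-fromℚᵘ (p ℚᵘ.* q) ⟩
  p ℚᵘ.* q                               ≈⟨ ℚᵘ.*-cong (toℚᵘ-fromℚᵘ p) (toℚᵘ-fromℚᵘ q) ⟨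
  toℚᵘ (fromℚᵘ p) ℚᵘ.* toℚᵘ (fromℚᵘ q)   ≈⟨ toℚᵘ-homo-* (fromℚᵘ p) (fromℚᵘ q) ⟨
  toℚᵘ (fromℚᵘ p * fromℚᵘ q)             ∎)
  where open SetoidReasoning ℚᵘ.≃-setoid

open ≡-Reasoning

fromℤ-homo-+ : ∀ i j → fromℤ (i ℤ.+ j) ≡ fromℤ i + fromℤ j
fromℤ-homo-+ i j = trans
  (fromℚᵘ-cong {mkℚᵘ (i ℤ.+ j) 0} {mkℚᵘ i 0 ℚᵘ.+ mkℚᵘ j 0}
    (*≡* (cong (ℤ._* + 1) (cong₂ ℤ._+_ (sym (ℤ.*-identityʳ i)) (sym (ℤ.*-identityʳ j))))))
  (fromℚᵘ-homo-+ (mkℚᵘ i 0) (mkℚᵘ j 0))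

fromℤ-homo-* : ∀ i j → fromℤ (i ℤ.* j) ≡ fromℤ i * fromℤ j
fromℤ-homo-* i j = fromℚᵘ-homo-* (mkℚᵘ i 0) (mkℚᵘ j 0)

fromℕ-homo-+ : ∀ m n → fromℕ (m ℕ.+ n) ≡ fromℕ m + fromℕ n
fromℕ-homo-+ m n = fromℤ-homo-+ (+ m) (+ n)

fromℕ-homo-* : ∀ m n → fromℕ (m ℕ.* n) ≡ fromℕ m * fromℕ n
fromℕ-homo-* m n =
  trans (cong fromℤ (ℤ.pos-* m n)) (fromℤ-homo-* (+ m) (+ n))

fromℕ-suc : ∀ n → fromℕ (suc n) ≡ 1ℚ + fromℕ n
fromℕ-suc = fromℕ-homo-+ 1

-- Turning every division into a product with `recip` lets the ring solver treat reciprocals as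
-- atoms.
recip : ℕ → ℚ
recip d = 1ℚ ÷ d

÷-recip : ∀ p d → p ÷ d ≡ p * recip d
÷-recip p zero    = sym (*-zeroʳ p)
÷-recip p (suc d) = cong (p *_) (sym (*-identityˡ (+ 1 / suc d)))

-- Division by 0 yields 0, so multiplicativity extends to zero arguments and applies directly to
-- factorials and powers, which are not visibly successors.
recip-* : ∀ m n → recip (m ℕ.* n) ≡ recip m * recip n
recip-* zero    n       = sym (*-zeroˡ (recip n))
recip-* (suc m) zero    =
  trans (cong recip (ℕ.*-zeroʳ m)) (sym (*-zeroʳ (recip (suc m))))
recip-* (suc m) (suc n) = begin
  recip (suc m ℕ.* suc n)           ≡⟨ *-identityˡ _ ⟩
  + 1 / (suc m ℕ.* suc n)           ≡⟨ fromℚᵘ-homo-* (mkℚᵘ (+ 1) m) (mkℚᵘ (+ 1) n) ⟩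
  (+ 1 / suc m) * (+ 1 / suc n)     ≡⟨ cong₂ _*_ (*-identityˡ (+ 1 / suc m)) (*-identityˡ (+ 1 / suc n)) ⟨
  recip (suc m) * recip (suc n)     ∎

fromℕ-recip : ∀ n → fromℕ (suc n) * recip (suc n) ≡ 1ℚ
fromℕ-recip n = begin
  fromℕ (suc n) * recip (suc n)     ≡⟨ cong (fromℕ (suc n) *_) (*-identityˡ (+ 1 / suc n)) ⟩
  fromℕ (suc n) * (+ 1 / suc n)     ≡⟨ fromℚᵘ-homo-* (mkℚᵘ (+ suc n) 0) (mkℚᵘ (+ 1) n) ⟨
  fromℚᵘ (mkℚᵘ (+ suc n) 0 ℚᵘ.* mkℚᵘ (+ 1) n)
    ≡⟨ fromℚᵘ-cong (ℚᵘ.*-inverseʳ (mkℚᵘ (+ suc n) 0)) ⟩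
  1ℚ                                ∎

fromℕ-*-cancel : ∀ n {x y} → fromℕ (suc n) * x ≡ fromℕ (suc n) * y → x ≡ y
fromℕ-*-cancel n {x} {y} eq =
  trans (sym (invert x)) (trans (cong (recip (suc n) *_) eq) (invert y))
  where
  invert : ∀ z → recip (suc n) * (fromℕ (suc n) * z) ≡ z
  invert z = begin
    recip (suc n) * (fromℕ (suc n) * z)
      ≡⟨ solve 3 (λ r m z → r :* (m :* z) := m :* r :* z) refl (recip (suc n)) (fromℕ (suc n)) z ⟩
    fromℕ (suc n) * recip (suc n) * z   ≡⟨ cong (_* z) (fromℕ-recip n) ⟩
    1ℚ * z                              ≡⟨ *-identityˡ z ⟩
    z                                   ∎

+-cancelʳ : ∀ z {x y} → x + z ≡ y + z → x ≡ y
+-cancelʳ z {x} {y} eq = trans (sym (drop x)) (trans (cong (_+ - z) eq) (drop y))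
  where
  drop : ∀ x → x + z + - z ≡ x
  drop x = solve 2 (λ x z → x :+ z :+ :- z := x) refl x z

-- Finite sums

∑-cong : ∀ n {f g} → (∀ i → i ℕ.≤ n → f i ≡ g i) → ∑≤ n f ≡ ∑≤ n g
∑-cong zero    eq = eq 0 z≤n
∑-cong (suc n) eq =
  cong₂ _+_ (∑-cong n (λ i i≤n → eq i (ℕ.m≤n⇒m≤1+n i≤n))) (eq (suc n) ℕ.≤-refl)

∑-zero : ∀ n {f} → (∀ i → i ℕ.≤ n → f i ≡ 0ℚ) → ∑≤ n f ≡ 0ℚ
∑-zero zero    eq = eq 0 z≤n
∑-zero (suc n) eq =
  cong₂ _+_ (∑-zero n (λ i i≤n → eq i (ℕ.m≤n⇒m≤1+n i≤n))) (eq (suc n) ℕ.≤-refl)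

∑-distrib-+ : ∀ n f g → ∑≤ n (λ i → f i + g i) ≡ ∑≤ n f + ∑≤ n g
∑-distrib-+ zero    f g = refl
∑-distrib-+ (suc n) f g = trans (cong (_+ (f (suc n) + g (suc n))) (∑-distrib-+ n f g))
  (solve 4 (λ a b c d → a :+ b :+ (c :+ d) := a :+ c :+ (b :+ d)) refl
    (∑≤ n f) (∑≤ n g) (f (suc n)) (g (suc n)))

*-distribˡ-∑ : ∀ x n f → x * ∑≤ n f ≡ ∑≤ n (λ i → x * f i)
*-distribˡ-∑ x zero    f = refl
*-distribˡ-∑ x (suc n) f =
  trans (*-distribˡ-+ x (∑≤ n f) (f (suc n))) (cong (_+ x * f (suc n)) (*-distribˡ-∑ x n f))

*-distribʳ-∑ : ∀ x n f → ∑≤ n f * x ≡ ∑≤ n (λ i → f i * x)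
*-distribʳ-∑ x n f = trans (*-comm (∑≤ n f) x)
  (trans (*-distribˡ-∑ x n f) (∑-cong n (λ i _ → *-comm x (f i))))

∑-first : ∀ n f → ∑≤ (suc n) f ≡ f 0 + ∑≤ n (λ i → f (suc i))
∑-first zero    f = refl
∑-first (suc n) f = trans (cong (_+ f (suc (suc n))) (∑-first n f))
  (+-assoc (f 0) (∑≤ n (λ i → f (suc i))) (f (suc (suc n))))

∑-last : ∀ n {f} → (∀ i → i ℕ.< n → f i ≡ 0ℚ) → ∑≤ n f ≡ f n
∑-last zero        eq = refl
∑-last (suc n) {f} eq = trans
  (cong (_+ f (suc n)) (∑-zero n (λ i i≤n → eq i (s≤s i≤n))))
  (+-identityˡ (f (suc n)))

∑-reverse : ∀ n f → ∑≤ n f ≡ ∑≤ n (λ i → f (n ∸ i))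
∑-reverse zero    f = refl
∑-reverse (suc n) f = begin
  ∑≤ n f + f (suc n)                      ≡⟨ +-comm (∑≤ n f) (f (suc n)) ⟩
  f (suc n) + ∑≤ n f                      ≡⟨ cong (_+_ (f (suc n))) (∑-reverse n f) ⟩
  f (suc n) + ∑≤ n (λ i → f (n ∸ i))      ≡⟨ ∑-first n (λ i → f (suc n ∸ i)) ⟨
  ∑≤ (suc n) (λ i → f (suc n ∸ i))        ∎

∑-swap : ∀ m n (f : ℕ → ℕ → ℚ) →
         ∑≤ m (λ i → ∑≤ n (f i)) ≡ ∑≤ n (λ j → ∑≤ m (λ i → f i j))
∑-swap zero    n f = refl
∑-swap (suc m) n f = trans (cong (_+ ∑≤ n (f (suc m))) (∑-swap m n f))
  (sym (∑-distrib-+ n (λ j → ∑≤ m (λ i → f i j)) (f (suc m))))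

-- Brings the sums that define a composition in different degrees to a common upper bound. The
-- relation `≤′` allows induction on that bound.
∑-truncate : ∀ m n f → m ℕ.≤′ n → (∀ i → m ℕ.< i → f i ≡ 0ℚ) → ∑≤ m f ≡ ∑≤ n f
∑-truncate m .m      f ℕ.≤′-refl       eq = refl
∑-truncate m (suc n) f (ℕ.≤′-step m≤n) eq = begin
  ∑≤ m f              ≡⟨ ∑-truncate m n f m≤n eq ⟩
  ∑≤ n f              ≡⟨ +-identityʳ (∑≤ n f) ⟨
  ∑≤ n f + 0ℚ         ≡⟨ cong (_+_ (∑≤ n f)) (eq (suc n) (s≤s (ℕ.≤′⇒≤ m≤n))) ⟨
  ∑≤ n f + f (suc n)  ∎

-- The semiring of formal power series

𝟘 : Series
𝟘 _ = 0ℚ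

_⊕_ : Series → Series → Series
(f ⊕ g) n = f n + g n

shift : Series → Series
shift f n = f (suc n)

≈-refl : ∀ {f} → f ≈ f
≈-refl _ = refl

≈-sym : ∀ {f g} → f ≈ g → g ≈ f
≈-sym f≈g n = sym (f≈g n)

≈-trans : ∀ {f g h} → f ≈ g → g ≈ h → f ≈ h
≈-trans f≈g g≈h n = trans (f≈g n) (g≈h n)

≈-isEquivalence : IsEquivalence _≈_
≈-isEquivalence = record { refl = ≈-refl ; sym = ≈-sym ; trans = ≈-trans }

⊕-cong : ∀ {f f′ g g′} → f ≈ f′ → g ≈ g′ → f ⊕ g ≈ f′ ⊕ g′
⊕-cong f≈f′ g≈g′ n = cong₂ _+_ (f≈f′ n) (g≈g′ n)

⊕-congˡ : ∀ f {g g′} → g ≈ g′ → f ⊕ g ≈ f ⊕ g′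
⊕-congˡ f = ⊕-cong {f} ≈-refl

⊕-congʳ : ∀ g {f f′} → f ≈ f′ → f ⊕ g ≈ f′ ⊕ g
⊕-congʳ g f≈f′ = ⊕-cong {g = g} f≈f′ ≈-refl

·-cong : ∀ {f f′ g g′} → f ≈ f′ → g ≈ g′ → f · g ≈ f′ · g′
·-cong f≈f′ g≈g′ n = ∑-cong n (λ i _ → cong₂ _*_ (f≈f′ i) (g≈g′ (n ∸ i)))

·-congˡ : ∀ f {g g′} → g ≈ g′ → f · g ≈ f · g′
·-congˡ f = ·-cong {f} ≈-refl

·-congʳ : ∀ g {f f′} → f ≈ f′ → f · g ≈ f′ · g
·-congʳ g f≈f′ = ·-cong {g = g} f≈f′ ≈-refl

-- Peeling off the constant term of the first factor gives a recursion on the degree, which replaces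
-- rearrangements of double sums below.
·-suc : ∀ f g n → (f · g) (suc n) ≡ f 0 * g (suc n) + (shift f · g) n
·-suc f g n = ∑-first n (λ i → f i * g (suc n ∸ i))

·-distribʳ : ∀ h f g → (f ⊕ g) · h ≈ (f · h) ⊕ (g · h)
·-distribʳ h f g n = trans
  (∑-cong n (λ i _ → *-distribʳ-+ (h (n ∸ i)) (f i) (g i)))
  (∑-distrib-+ n (λ i → f i * h (n ∸ i)) (λ i → g i * h (n ∸ i)))

·-scaleˡ : ∀ x f g n → ((λ i → x * f i) · g) n ≡ x * (f · g) n
·-scaleˡ x f g n = trans
  (∑-cong n (λ i _ → *-assoc x (f i) (g (n ∸ i))))
  (sym (*-distribˡ-∑ x n (λ i → f i * g (n ∸ i))))

·-comm : ∀ f g → f · g ≈ g · f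
·-comm f g n = trans (∑-reverse n (λ i → f i * g (n ∸ i))) (∑-cong n λ i i≤n → begin
  f (n ∸ i) * g (n ∸ (n ∸ i))  ≡⟨ cong (λ j → f (n ∸ i) * g j) (ℕ.m∸[m∸n]≡n i≤n) ⟩
  f (n ∸ i) * g i              ≡⟨ *-comm (f (n ∸ i)) (g i) ⟩
  g i * f (n ∸ i)              ∎)

-- Induction on the degree with `f` general: the hypothesis is applied to `shift f`.
·-assoc : ∀ f g h → (f · g) · h ≈ f · (g · h)
·-assoc f g h zero    = *-assoc (f 0) (g 0) (h 0)
·-assoc f g h (suc n) = begin
  ((f · g) · h) (suc n)
    ≡⟨ ·-suc (f · g) h n ⟩
  f 0 * g 0 * h (suc n) + (shift (f · g) · h) n
    ≡⟨ cong (_+_ (f 0 * g 0 * h (suc n))) (begin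
         (shift (f · g) · h) n
           ≡⟨ ·-congʳ h (·-suc f g) n ⟩
         (((λ i → f 0 * shift g i) ⊕ (shift f · g)) · h) n
           ≡⟨ ·-distribʳ h (λ i → f 0 * shift g i) (shift f · g) n ⟩
         ((λ i → f 0 * shift g i) · h) n + ((shift f · g) · h) n
           ≡⟨ cong₂ _+_ (·-scaleˡ (f 0) (shift g) h n) (·-assoc (shift f) g h n) ⟩
         f 0 * (shift g · h) n + (shift f · (g · h)) n ∎) ⟩
  f 0 * g 0 * h (suc n) + (f 0 * (shift g · h) n + (shift f · (g · h)) n)
    ≡⟨ solve 5 (λ a b c d e → a :* b :* c :+ (a :* d :+ e) := a :* (b :* c :+ d) :+ e) refl
         (f 0) (g 0) (h (suc n)) ((shift g · h) n) ((shift f · (g · h)) n) ⟩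
  f 0 * (g 0 * h (suc n) + (shift g · h) n) + (shift f · (g · h)) n
    ≡⟨ cong (λ x → f 0 * x + (shift f · (g · h)) n) (·-suc g h n) ⟨
  f 0 * (g · h) (suc n) + (shift f · (g · h)) n
    ≡⟨ ·-suc f (g · h) n ⟨
  (f · (g · h)) (suc n) ∎

·-zeroˡ : ∀ f → 𝟘 · f ≈ 𝟘
·-zeroˡ f n = ∑-zero n (λ i _ → *-zeroˡ (f (n ∸ i)))

·-identityˡ : ∀ f → 𝟙 · f ≈ f
·-identityˡ f zero    = *-identityˡ (f 0)
·-identityˡ f (suc n) = begin
  (𝟙 · f) (suc n)           ≡⟨ ·-suc 𝟙 f n ⟩
  1ℚ * f (suc n) + (𝟘 · f) n ≡⟨ cong₂ _+_ (*-identityˡ (f (suc n))) (·-zeroˡ f n) ⟩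
  f (suc n) + 0ℚ            ≡⟨ +-identityʳ (f (suc n)) ⟩
  f (suc n)                 ∎

-- Gives a solver for identities between series. Series carry no negation here, so the later
-- identities are kept free of subtraction.
series-commutativeSemiring : CommutativeSemiring 0ℓ 0ℓ
series-commutativeSemiring = record
  { _≈_ = _≈_
  ; _+_ = _⊕_
  ; _*_ = _·_
  ; 0#  = 𝟘
  ; 1#  = 𝟙
  ; isCommutativeSemiring = Biased.isCommutativeSemiringˡ record
    { +-isCommutativeMonoid = Biased.isCommutativeMonoidˡ record
      { isSemigroup = record
        { isMagma = record { isEquivalence = ≈-isEquivalence ; ∙-cong = ⊕-cong }
        ; assoc   = λ f g h n → +-assoc (f n) (g n) (h n)
        }
      ; identityˡ = λ f n → +-identityˡ (f n)
      ; comm      = λ f g n → +-comm (f n) (g n)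
      }
    ; *-isCommutativeMonoid = Biased.isCommutativeMonoidˡ record
      { isSemigroup = record
        { isMagma = record { isEquivalence = ≈-isEquivalence ; ∙-cong = ·-cong }
        ; assoc   = ·-assoc
        }
      ; identityˡ = ·-identityˡ
      ; comm      = ·-comm
      }
    ; distribʳ = ·-distribʳ
    ; zeroˡ    = ·-zeroˡ
    }
  }

open SetoidReasoning (CommutativeSemiring.setoid series-commutativeSemiring)
  using (step-≈-⟩; step-≈-⟨) renaming (begin_ to begin-≈_; _∎ to _□)

open SemiringSolver series-commutativeSemiring
  using () renaming (solve to ≈-solve; con to :con; _:+_ to _:⊕_; _:*_ to _:·_; _:=_ to _:≈_)

-- Scalars and multiplication by t

·-scaleʳ : ∀ x f g n → (f · (λ i → x * g i)) n ≡ x * (f · g) n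
·-scaleʳ x f g n = begin
  (f · (λ i → x * g i)) n  ≡⟨ ·-comm f (λ i → x * g i) n ⟩
  ((λ i → x * g i) · f) n  ≡⟨ ·-scaleˡ x g f n ⟩
  x * (g · f) n            ≡⟨ cong (x *_) (·-comm g f n) ⟩
  x * (f · g) n            ∎

t·-cong : ∀ {f g} → f ≈ g → t· f ≈ t· g
t·-cong f≈g zero    = refl
t·-cong f≈g (suc n) = f≈g n

t·-· : ∀ f g → (t· f) · g ≈ t· (f · g)
t·-· f g zero    = *-zeroˡ (g 0)
t·-· f g (suc n) = begin
  ((t· f) · g) (suc n)          ≡⟨ ·-suc (t· f) g n ⟩
  0ℚ * g (suc n) + (f · g) n    ≡⟨ cong (_+ (f · g) n) (*-zeroˡ (g (suc n))) ⟩
  0ℚ + (f · g) n                ≡⟨ +-identityˡ ((f · g) n) ⟩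
  (f · g) n                     ∎

t-· : ∀ f → t · f ≈ t· f
t-· f = ≈-trans (t·-· 𝟙 f) (t·-cong (·-identityˡ f))

t²-· : ∀ f → t · t · f ≈ t· (t· f)
t²-· f = ≈-trans (·-assoc t t f) (≈-trans (t-· (t · f)) (t·-cong (t-· f)))

-- Multiplication by t only shifts coefficients, so the equality is read off one degree higher.
·t-cancel : ∀ {f g} → f · t ≈ g · t → f ≈ g
·t-cancel {f} {g} eq n =
  trans (sym (coefficient f)) (trans (eq (suc n)) (coefficient g))
  where
  coefficient : ∀ f → (f · t) (suc n) ≡ f n
  coefficient f = trans (·-comm f t (suc n)) (t-· f (suc n))

-- Derivations and the chain rule

-- `θ` preserves the degree, which suits products; `∂` is d/dt itself, as the outer series in the
-- chain rule requires.
θ : Series → Series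
θ f n = fromℕ n * f n

∂ : Series → Series
∂ f n = fromℕ (suc n) * f (suc n)

θ-cong : ∀ {f g} → f ≈ g → θ f ≈ θ g
θ-cong f≈g n = cong (fromℕ n *_) (f≈g n)

θ-⊕ : ∀ f g → θ (f ⊕ g) ≈ θ f ⊕ θ g
θ-⊕ f g n = *-distribˡ-+ (fromℕ n) (f n) (g n)

θ-𝟙 : θ 𝟙 ≈ 𝟘
θ-𝟙 zero    = refl
θ-𝟙 (suc n) = *-zeroʳ (fromℕ (suc n))

θ-t : θ t ≈ t
θ-t zero          = refl
θ-t (suc zero)    = refl
θ-t (suc (suc n)) = *-zeroʳ (fromℕ (suc (suc n)))

-- The weight n of each summand splits as i + (n - i), one part for each factor.
θ-· : ∀ f g → θ (f · g) ≈ (θ f · g) ⊕ (f · θ g)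
θ-· f g n = begin
  fromℕ n * (f · g) n
    ≡⟨ *-distribˡ-∑ (fromℕ n) n (λ i → f i * g (n ∸ i)) ⟩
  ∑≤ n (λ i → fromℕ n * (f i * g (n ∸ i)))
    ≡⟨ ∑-cong n (λ i i≤n → begin
         fromℕ n * (f i * g (n ∸ i))
           ≡⟨ cong (λ m → fromℕ m * (f i * g (n ∸ i))) (ℕ.m+[n∸m]≡n i≤n) ⟨
         fromℕ (i ℕ.+ (n ∸ i)) * (f i * g (n ∸ i))
           ≡⟨ cong (_* (f i * g (n ∸ i))) (fromℕ-homo-+ i (n ∸ i)) ⟩
         (fromℕ i + fromℕ (n ∸ i)) * (f i * g (n ∸ i))
           ≡⟨ solve 4 (λ p q x y → (p :+ q) :* (x :* y) := p :* x :* y :+ x :* (q :* y)) refl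
                (fromℕ i) (fromℕ (n ∸ i)) (f i) (g (n ∸ i)) ⟩
         θ f i * g (n ∸ i) + f i * θ g (n ∸ i) ∎) ⟩
  ∑≤ n (λ i → θ f i * g (n ∸ i) + f i * θ g (n ∸ i))
    ≡⟨ ∑-distrib-+ n (λ i → θ f i * g (n ∸ i)) (λ i → f i * θ g (n ∸ i)) ⟩
  (θ f · g) n + (f · θ g) n ∎

-- In characteristic 0 the kernel of `θ` consists of the constants, hence the condition on the
-- constant terms.
θ-injective : ∀ {f g} → f 0 ≡ g 0 → θ f ≈ θ g → f ≈ g
θ-injective f₀≡g₀ θf≈θg zero    = f₀≡g₀
θ-injective f₀≡g₀ θf≈θg (suc n) = fromℕ-*-cancel n (θf≈θg (suc n))

θ-^ : ∀ g k → θ (g ^ suc k) ≈ (λ n → fromℕ (suc k) * (g ^ k · θ g) n)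
θ-^ g zero n = begin
  fromℕ n * (g · 𝟙) n   ≡⟨ cong (fromℕ n *_) (·-comm g 𝟙 n) ⟩
  fromℕ n * (𝟙 · g) n   ≡⟨ cong (fromℕ n *_) (·-identityˡ g n) ⟩
  θ g n                 ≡⟨ ·-identityˡ (θ g) n ⟨
  (𝟙 · θ g) n           ≡⟨ *-identityˡ ((𝟙 · θ g) n) ⟨
  1ℚ * (𝟙 · θ g) n      ∎
θ-^ g (suc k) n = begin
  θ (g · h) n
    ≡⟨ θ-· g h n ⟩
  (θ g · h) n + (g · θ h) n
    ≡⟨ cong₂ _+_ (·-comm (θ g) h n) (begin
         (g · θ h) n                                 ≡⟨ ·-congˡ g (θ-^ g k) n ⟩
         (g · (λ i → fromℕ (suc k) * (g ^ k · θ g) i)) n ≡⟨ ·-scaleʳ (fromℕ (suc k)) g (g ^ k · θ g) n ⟩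
         fromℕ (suc k) * (g · (g ^ k · θ g)) n       ≡⟨ cong (fromℕ (suc k) *_) (·-assoc g (g ^ k) (θ g) n) ⟨
         fromℕ (suc k) * (h · θ g) n                 ∎) ⟩
  (h · θ g) n + fromℕ (suc k) * (h · θ g) n
    ≡⟨ solve 2 (λ x y → y :+ x :* y := (con 1ℚ :+ x) :* y) refl (fromℕ (suc k)) ((h · θ g) n) ⟩
  (1ℚ + fromℕ (suc k)) * (h · θ g) n
    ≡⟨ cong (_* (h · θ g) n) (fromℕ-suc (suc k)) ⟨
  fromℕ (suc (suc k)) * (h · θ g) n ∎
  where h = g ^ suc k

-- As t divides g, tᵏ divides gᵏ. In the product g · gᵏ⁻¹ the summand for i = 0 vanishes through
-- `g 0`, the others through the induction hypothesis.
^-vanish : ∀ {g} → g 0 ≡ 0ℚ → ∀ k n → n ℕ.< k → (g ^ k) n ≡ 0ℚ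
^-vanish {g} g₀≡0 (suc k) n n<1+k = ∑-zero n (term n n<1+k)
  where
  term : ∀ n → n ℕ.< suc k → ∀ i → i ℕ.≤ n → g i * (g ^ k) (n ∸ i) ≡ 0ℚ
  term n       n<1+k       zero    _ =
    trans (cong (_* (g ^ k) n) g₀≡0) (*-zeroˡ ((g ^ k) n))
  term (suc n) (s≤s n<k) (suc i) _ =
    trans (cong (g (suc i) *_) (^-vanish g₀≡0 k (n ∸ i) (ℕ.≤-<-trans (ℕ.m∸n≤m n i) n<k)))
          (*-zeroʳ (g (suc i)))

-- The power rule `θ-^` is applied term by term, then the sums over the exponent k and the degree i
-- are exchanged.
θ-∘ : ∀ f {g} → g 0 ≡ 0ℚ → θ (f ∘ g) ≈ (∂ f ∘ g) · θ g
θ-∘ f {g} g₀≡0 zero = begin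
  0ℚ * (f ∘ g) 0               ≡⟨ *-zeroˡ ((f ∘ g) 0) ⟩
  0ℚ                           ≡⟨ *-zeroʳ ((∂ f ∘ g) 0) ⟨
  (∂ f ∘ g) 0 * 0ℚ             ≡⟨ cong ((∂ f ∘ g) 0 *_) (*-zeroˡ (g 0)) ⟨
  (∂ f ∘ g) 0 * (0ℚ * g 0)     ∎
θ-∘ f {g} g₀≡0 (suc n) = begin
  θ (f ∘ g) (suc n)
    ≡⟨ *-distribˡ-∑ (fromℕ (suc n)) (suc n) (λ k → f k * (g ^ k) (suc n)) ⟩
  ∑≤ (suc n) (λ k → fromℕ (suc n) * (f k * (g ^ k) (suc n)))
    ≡⟨ ∑-first n (λ k → fromℕ (suc n) * (f k * (g ^ k) (suc n))) ⟩
  -- The factor `0ℚ` is `(g ^ 0) (suc n)`: the constant term of `f` contributes nothing.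
  fromℕ (suc n) * (f 0 * 0ℚ) + ∑≤ n (λ k → fromℕ (suc n) * (f (suc k) * (g ^ suc k) (suc n)))
    ≡⟨ solve 3 (λ x y z → x :* (y :* con 0ℚ) :+ z := z) refl (fromℕ (suc n)) (f 0)
         (∑≤ n (λ k → fromℕ (suc n) * (f (suc k) * (g ^ suc k) (suc n)))) ⟩
  ∑≤ n (λ k → fromℕ (suc n) * (f (suc k) * (g ^ suc k) (suc n)))
    ≡⟨ ∑-cong n (λ k _ → differentiate k) ⟩
  ∑≤ n (λ k → ∑≤ n (λ i → ∂ f k * (g ^ k) i * θ g (suc n ∸ i)))
    ≡⟨ ∑-swap n n (λ k i → ∂ f k * (g ^ k) i * θ g (suc n ∸ i)) ⟩
  ∑≤ n (λ i → ∑≤ n (λ k → ∂ f k * (g ^ k) i * θ g (suc n ∸ i)))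
    ≡⟨ ∑-cong n (λ i i≤n → trans
         (sym (*-distribʳ-∑ (θ g (suc n ∸ i)) n (λ k → ∂ f k * (g ^ k) i)))
         (cong (_* θ g (suc n ∸ i)) (sym (extend i i≤n)))) ⟩
  ∑≤ n (λ i → (∂ f ∘ g) i * θ g (suc n ∸ i))
    ≡⟨ drop-last (∂ f ∘ g) ⟨
  ((∂ f ∘ g) · θ g) (suc n) ∎
  where
  -- `θ g` has constant term 0, so the last summand disappears and i runs up to n, the same bound as
  -- for k.
  drop-last : ∀ h → (h · θ g) (suc n) ≡ ∑≤ n (λ i → h i * θ g (suc n ∸ i))
  drop-last h = begin
    S + h (suc n) * θ g (n ∸ n)
      ≡⟨ cong (λ m → S + h (suc n) * θ g m) (ℕ.n∸n≡0 n) ⟩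
    S + h (suc n) * (0ℚ * g 0)
      ≡⟨ solve 3 (λ x y z → x :+ y :* (con 0ℚ :* z) := x) refl S (h (suc n)) (g 0) ⟩
    S ∎
    where S = ∑≤ n (λ i → h i * θ g (suc n ∸ i))

  -- In degree i the composition stops at k = i; the powers of g with i < k ≤ n may be added because
  -- they vanish there.
  extend : ∀ i → i ℕ.≤ n → (∂ f ∘ g) i ≡ ∑≤ n (λ k → ∂ f k * (g ^ k) i)
  extend i i≤n = ∑-truncate i n (λ k → ∂ f k * (g ^ k) i) (ℕ.≤⇒≤′ i≤n) (λ k i<k →
    trans (cong (∂ f k *_) (^-vanish g₀≡0 k i i<k)) (*-zeroʳ (∂ f k)))

  differentiate : ∀ k → fromℕ (suc n) * (f (suc k) * (g ^ suc k) (suc n))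
                        ≡ ∑≤ n (λ i → ∂ f k * (g ^ k) i * θ g (suc n ∸ i))
  differentiate k = begin
    fromℕ (suc n) * (f (suc k) * (g ^ suc k) (suc n))
      ≡⟨ solve 3 (λ x y z → x :* (y :* z) := y :* (x :* z)) refl
           (fromℕ (suc n)) (f (suc k)) ((g ^ suc k) (suc n)) ⟩
    f (suc k) * θ (g ^ suc k) (suc n)
      ≡⟨ cong (f (suc k) *_) (θ-^ g k (suc n)) ⟩
    f (suc k) * (fromℕ (suc k) * (g ^ k · θ g) (suc n))
      ≡⟨ solve 3 (λ x y z → y :* (x :* z) := x :* y :* z) refl
           (fromℕ (suc k)) (f (suc k)) ((g ^ k · θ g) (suc n)) ⟩
    ∂ f k * (g ^ k · θ g) (suc n)
      ≡⟨ cong (∂ f k *_) (drop-last (g ^ k)) ⟩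
    ∂ f k * ∑≤ n (λ i → (g ^ k) i * θ g (suc n ∸ i))
      ≡⟨ *-distribˡ-∑ (∂ f k) n (λ i → (g ^ k) i * θ g (suc n ∸ i)) ⟩
    ∑≤ n (λ i → ∂ f k * ((g ^ k) i * θ g (suc n ∸ i)))
      ≡⟨ ∑-cong n (λ i _ → sym (*-assoc (∂ f k) ((g ^ k) i) (θ g (suc n ∸ i)))) ⟩
    ∑≤ n (λ i → ∂ f k * (g ^ k) i * θ g (suc n ∸ i)) ∎

∘-cong : ∀ {f f′ g} → f ≈ f′ → f ∘ g ≈ f′ ∘ g
∘-cong {g = g} f≈f′ n = ∑-cong n (λ k _ → cong (_* (g ^ k) n) (f≈f′ k))

-- Even series

even-cong : ∀ {u v} → (∀ k → u k ≡ v k) → even u ≈ even v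
even-cong eq zero          = eq 0
even-cong eq (suc zero)    = refl
even-cong eq (suc (suc n)) = even-cong (λ k → eq (suc k)) n

even-double : ∀ u n → even u (2 ℕ.* n) ≡ u n
even-double u zero    = refl
even-double u (suc n) =
  trans (cong (even u) (ℕ.*-suc 2 n)) (even-double (λ k → u (suc k)) n)

even-+ : ∀ u v → even (λ k → u k + v k) ≈ even u ⊕ even v
even-+ u v zero          = refl
even-+ u v (suc zero)    = refl
even-+ u v (suc (suc n)) = even-+ (λ k → u (suc k)) (λ k → v (suc k)) n

-- Weights at odd degrees meet zero coefficients. The weight is arbitrary because the induction
-- replaces `w` by its shift by 2; constants give scaling and `fromℕ` gives `θ`.
even-weight : ∀ (w u : ℕ → ℚ) n → w n * even u n ≡ even (λ k → w (2 ℕ.* k) * u k) n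
even-weight w u zero          = refl
even-weight w u (suc zero)    = *-zeroʳ (w 1)
even-weight w u (suc (suc n)) = trans
  (even-weight (λ m → w (2 ℕ.+ m)) (λ k → u (suc k)) n)
  (even-cong (λ k → cong (λ m → w m * u (suc k)) (sym (ℕ.*-suc 2 k))) n)

even-scale : ∀ x u n → x * even u n ≡ even (λ k → x * u k) n
even-scale x = even-weight (λ _ → x)

even-t· : ∀ u → even (t· u) ≈ t· (t· (even u))
even-t· u zero          = refl
even-t· u (suc zero)    = refl
even-t· u (suc (suc n)) = refl

-- Substitution of t² respects products. Peeling two coefficients off `even u`, of which the second
-- is 0, peels one off `u`.
even-· : ∀ u v → even u · even v ≈ even (u · v)
even-· u v zero          = refl
even-· u v (suc zero)    =
  solve 2 (λ x y → x :* con 0ℚ :+ con 0ℚ :* y := con 0ℚ) refl (u 0) (v 0)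
even-· u v (suc (suc n)) = begin
  (even u · even v) (suc (suc n))
    ≡⟨ ·-suc (even u) (even v) (suc n) ⟩
  u 0 * even (shift v) n + (shift (even u) · even v) (suc n)
    ≡⟨ cong (_+_ (u 0 * even (shift v) n)) (begin
         (shift (even u) · even v) (suc n)
           ≡⟨ ·-suc (shift (even u)) (even v) n ⟩
         0ℚ * even v (suc n) + (even (shift u) · even v) n
           ≡⟨ cong₂ _+_ (*-zeroˡ (even v (suc n))) (even-· (shift u) v n) ⟩
         0ℚ + even (shift u · v) n
           ≡⟨ +-identityˡ (even (shift u · v) n) ⟩
         even (shift u · v) n ∎) ⟩
  u 0 * even (shift v) n + even (shift u · v) n
    ≡⟨ cong (_+ even (shift u · v) n) (even-scale (u 0) (shift v) n) ⟩
  even (λ k → u 0 * shift v k) n + even (shift u · v) n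
    ≡⟨ even-+ (λ k → u 0 * shift v k) (shift u · v) n ⟨
  even (λ k → u 0 * shift v k + (shift u · v) k) n
    ≡⟨ even-cong (·-suc u v) n ⟨
  even (shift (u · v)) n ∎

-- The coefficients of √(1 + t²)

-- This is (1 + t²) θf = t² f, written with shifts so that each coefficient of the equation
-- computes.
SatisfiesODE : Series → Set
SatisfiesODE f = θ f ⊕ (t· (t· (θ f))) ≈ t· (t· f)

-- In degree n + 2 the equation reads (n + 2) fₙ₊₂ + n fₙ = fₙ, a recursion in steps of two. In
-- degree 1 it forces f₁ = 0, so the constant term determines everything.
ODE-unique : ∀ {f g} → SatisfiesODE f → SatisfiesODE g → f 0 ≡ g 0 → f ≈ g
ODE-unique odeᶠ odeᵍ f₀≡g₀ zero = f₀≡g₀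
ODE-unique odeᶠ odeᵍ f₀≡g₀ (suc zero) =
  fromℕ-*-cancel 0 (+-cancelʳ 0ℚ (trans (odeᶠ 1) (sym (odeᵍ 1))))
ODE-unique {f} {g} odeᶠ odeᵍ f₀≡g₀ (suc (suc n)) =
  fromℕ-*-cancel (suc n) (+-cancelʳ (θ f n) (begin
    θ f (suc (suc n)) + θ f n   ≡⟨ odeᶠ (suc (suc n)) ⟩
    f n                         ≡⟨ fₙ≡gₙ ⟩
    g n                         ≡⟨ odeᵍ (suc (suc n)) ⟨
    θ g (suc (suc n)) + θ g n   ≡⟨ cong (λ x → θ g (suc (suc n)) + fromℕ n * x) fₙ≡gₙ ⟨
    θ g (suc (suc n)) + θ f n   ∎))
  where
  fₙ≡gₙ : f n ≡ g n
  fₙ≡gₙ = ODE-unique odeᶠ odeᵍ f₀≡g₀ n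

-- The value (2k-3)!!, which starts with (-3)!! = -1 and (-1)!! = 1.
oddFactorial : ℕ → ℚ
oddFactorial k = (+ (2 ℕ.* k) ℤ.- + 3) !!

-- This is m!! = m (m-2)!! for m = 2k-1. The extension to negative odd integers keeps it valid for k
-- = 0 and k = 1, where both sides compute.
oddFactorial-suc : ∀ k →
  oddFactorial (suc k) ≡ fromℤ (+ (2 ℕ.* k) ℤ.- + 1) * oddFactorial k
oddFactorial-suc zero          = refl
oddFactorial-suc (suc zero)    = refl
oddFactorial-suc (suc (suc k)) = begin
  (+ (2 ℕ.* suc (suc (suc k))) ℤ.- + 3) !!
    ≡⟨ cong (λ m → (+ m ℤ.- + 3) !!) (trans (ℕ.*-suc 2 (suc (suc k))) (cong (2 ℕ.+_) eq)) ⟩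
  fromℕ ((3 ℕ.+ 2 ℕ.* k) ‼)
    ≡⟨ fromℕ-homo-* (3 ℕ.+ 2 ℕ.* k) ((1 ℕ.+ 2 ℕ.* k) ‼) ⟩
  fromℕ (3 ℕ.+ 2 ℕ.* k) * fromℕ ((1 ℕ.+ 2 ℕ.* k) ‼)
    ≡⟨ cong (λ m → fromℤ (+ m ℤ.- + 1) * (+ m ℤ.- + 3) !!) eq ⟨
  fromℤ (+ (2 ℕ.* suc (suc k)) ℤ.- + 1) * oddFactorial (suc (suc k)) ∎
  where
  eq : 2 ℕ.* suc (suc k) ≡ 4 ℕ.+ 2 ℕ.* k
  eq = trans (ℕ.*-suc 2 (suc k)) (cong (2 ℕ.+_) (ℕ.*-suc 2 k))

-- (-1)ᵏ⁺¹ (2k-3)!! / (2ᵏ k!), the binomial coefficient of ½ over k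
√-coefficient : ℕ → ℚ
√-coefficient k =
  - (fromℤ (-1ℤ ℤ.^ k) * oddFactorial k * recip (2 ℕ.^ k ℕ.* k !))

-- The coefficient of t²ᵏ⁺² in (1 + t²) θf = t² f; equivalently, successive binomial coefficients of
-- ½ have ratio (½ - k) / (k + 1).
√-coefficient-suc : ∀ k →
  fromℕ (2 ℕ.* suc k) * √-coefficient (suc k) + fromℕ (2 ℕ.* k) * √-coefficient k
    ≡ √-coefficient k
√-coefficient-suc k = begin
  fromℕ (2 ℕ.* suc k) * √-coefficient (suc k) + x * √-coefficient k
    ≡⟨ cong₂ (λ m p → m * - p + x * √-coefficient k) (fromℕ-homo-* 2 (suc k))
         (cong₂ _*_ (cong₂ _*_ (fromℤ-homo-* -1ℤ (-1ℤ ℤ.^ k))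
            (trans (oddFactorial-suc k) (cong (_* d) (fromℤ-homo-+ (+ (2 ℕ.* k)) (ℤ.- + 1)))))
            (trans (recip-* (2 ℕ.* 2 ℕ.^ k) (suc k ℕ.* k !))
              (cong₂ _*_ (recip-* 2 (2 ℕ.^ k)) (recip-* (suc k) (k !))))) ⟩
  fromℕ 2 * m * - (- 1ℚ * e * ((x + - 1ℚ) * d) * (recip 2 * a * (recip (suc k) * b)))
    + x * √-coefficient k
    -- The solver cancels 2 against `recip 2` and the two signs, and places k + 1 beside its
    -- reciprocal for the next step.
    ≡⟨ solve 8 (λ m e x d a r b y →
         con (fromℕ 2) :* m :* :- (:- con 1ℚ :* e :* ((x :+ :- con 1ℚ) :* d)
           :* (con (recip 2) :* a :* (r :* b))) :+ x :* y
         := m :* r :* (e :* d :* (a :* b)) :* (x :+ :- con 1ℚ) :+ x :* y)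
         refl m e x d a (recip (suc k)) b (√-coefficient k) ⟩
  m * recip (suc k) * (e * d * (a * b)) * (x + - 1ℚ) + x * √-coefficient k
    ≡⟨ cong₂ (λ p q → p * (e * d * q) * (x + - 1ℚ) + x * √-coefficient k)
         (fromℕ-recip k) (sym (recip-* (2 ℕ.^ k) (k !))) ⟩
  1ℚ * y * (x + - 1ℚ) + x * - y
    ≡⟨ solve 2 (λ x y → con 1ℚ :* y :* (x :+ :- con 1ℚ) :+ x :* :- y := :- y) refl x y ⟩
  √-coefficient k ∎
  where
  m = fromℕ (suc k)
  x = fromℕ (2 ℕ.* k)
  e = fromℤ (-1ℤ ℤ.^ k)
  d = oddFactorial k
  a = recip (2 ℕ.^ k)
  b = recip (k !)
  y = e * d * recip (2 ℕ.^ k ℕ.* k !)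

√-ODE : SatisfiesODE (even √-coefficient)
√-ODE n = begin
  θ (even √-coefficient) n + (t· (t· (θ (even √-coefficient)))) n
    ≡⟨ cong₂ _+_ (θ-even n) (t·-cong (t·-cong θ-even) n) ⟩
  even v n + (t· (t· (even v))) n
    ≡⟨ cong (_+_ (even v n)) (even-t· v n) ⟨
  even v n + even (t· v) n
    ≡⟨ even-+ v (t· v) n ⟨
  even (λ k → v k + (t· v) k) n
    -- The constant terms on both sides compute to 0; all others are instances of the recurrence.
    ≡⟨ even-cong (λ { zero → refl ; (suc k) → √-coefficient-suc k }) n ⟩
  even (t· √-coefficient) n
    ≡⟨ even-t· √-coefficient n ⟩
  (t· (t· (even √-coefficient))) n ∎
  where
  v : ℕ → ℚ
  v k = fromℕ (2 ℕ.* k) * √-coefficient k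

  θ-even : θ (even √-coefficient) ≈ even v
  θ-even = even-weight fromℕ √-coefficient

-- Hyperbolic functions

-- As the derivative of `sinh` it appears directly in the chain rule for `sinh ∘ arcsinh`; what
-- remains to be shown is that its own derivative is `sinh`.
cosh : Series
cosh = ∂ sinh

-- Two derivatives produce (n+2)(n+3), which for n = 2k cancels the two leading factors of (2k+3)!.
∂-cosh : ∂ cosh ≈ sinh
∂-cosh zero    = refl
∂-cosh (suc n) = begin
  fromℕ (2 ℕ.+ n) * (fromℕ (3 ℕ.+ n) * even (shift e) n)
    ≡⟨ *-assoc (fromℕ (2 ℕ.+ n)) (fromℕ (3 ℕ.+ n)) (even (shift e) n) ⟨
  fromℕ (2 ℕ.+ n) * fromℕ (3 ℕ.+ n) * even (shift e) n
    ≡⟨ even-weight (λ m → fromℕ (2 ℕ.+ m) * fromℕ (3 ℕ.+ m)) (shift e) n ⟩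
  even (λ k → fromℕ (2 ℕ.+ 2 ℕ.* k) * fromℕ (3 ℕ.+ 2 ℕ.* k) * e (suc k)) n
    ≡⟨ even-cong cancel n ⟩
  even e n ∎
  where
  e : ℕ → ℚ
  e k = 1ℚ ÷ (2 ℕ.* k ℕ.+ 1) !

  cancel : ∀ k → fromℕ (2 ℕ.+ 2 ℕ.* k) * fromℕ (3 ℕ.+ 2 ℕ.* k) * e (suc k) ≡ e k
  cancel k = begin
    p * q * recip ((2 ℕ.* suc k ℕ.+ 1) !)
      ≡⟨ cong (λ m → p * q * recip (m !)) index ⟩
    p * q * recip (suc (suc m) ℕ.* (suc m ℕ.* m !))
      ≡⟨ cong (p * q *_) (trans (recip-* (suc (suc m)) (suc m ℕ.* m !))
           (cong (recip (suc (suc m)) *_) (recip-* (suc m) (m !)))) ⟩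
    p * q * (recip (suc (suc m)) * (recip (suc m) * recip (m !)))
      ≡⟨ cong₂ (λ i j → fromℕ i * fromℕ j * (recip (suc (suc m)) * (recip (suc m) * recip (m !))))
           (cong suc (ℕ.+-comm 1 (2 ℕ.* k))) (cong (2 ℕ.+_) (ℕ.+-comm 1 (2 ℕ.* k))) ⟩
    fromℕ (suc m) * fromℕ (suc (suc m)) * (recip (suc (suc m)) * (recip (suc m) * recip (m !)))
      ≡⟨ solve 5 (λ p q r s z → p :* q :* (r :* (s :* z)) := p :* s :* (q :* r) :* z) refl
           (fromℕ (suc m)) (fromℕ (suc (suc m))) (recip (suc (suc m))) (recip (suc m)) (recip (m !)) ⟩
    fromℕ (suc m) * recip (suc m) * (fromℕ (suc (suc m)) * recip (suc (suc m))) * recip (m !)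
      ≡⟨ cong₂ (λ x y → x * y * recip (m !)) (fromℕ-recip m) (fromℕ-recip (suc m)) ⟩
    1ℚ * 1ℚ * recip (m !)
      ≡⟨ *-identityˡ (recip (m !)) ⟩
    recip (m !) ∎
    where
    m = 2 ℕ.* k ℕ.+ 1
    p = fromℕ (2 ℕ.+ 2 ℕ.* k)
    q = fromℕ (3 ℕ.+ 2 ℕ.* k)

    index : 2 ℕ.* suc k ℕ.+ 1 ≡ suc (suc m)
    index = cong (ℕ._+ 1) (ℕ.*-suc 2 k)

-- Differential identities for arcsinh and its reciprocal

module _ {arcsinh : Series} (arcsinh₀≡0 : arcsinh 0 ≡ 0ℚ)
         (sinh∘arcsinh≈t : sinh ∘ arcsinh ≈ t) where

  private
    C : Series
    C = cosh ∘ arcsinh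

  cosh-·-θarcsinh : C · θ arcsinh ≈ t
  cosh-·-θarcsinh = begin-≈
    C · θ arcsinh        ≈⟨ θ-∘ sinh arcsinh₀≡0 ⟨
    θ (sinh ∘ arcsinh)   ≈⟨ θ-cong sinh∘arcsinh≈t ⟩
    θ t                  ≈⟨ θ-t ⟩
    t                    □

  θ-cosh : θ C ≈ t · θ arcsinh
  θ-cosh = begin-≈
    θ C                         ≈⟨ θ-∘ cosh arcsinh₀≡0 ⟩
    (∂ cosh ∘ arcsinh) · θ arcsinh
      ≈⟨ ·-congʳ (θ arcsinh) (≈-trans (∘-cong ∂-cosh) sinh∘arcsinh≈t) ⟩
    t · θ arcsinh               □

  cosh-·-θcosh : C · θ C ≈ t · t
  cosh-·-θcosh = begin-≈
    C · θ C                ≈⟨ ·-congˡ C θ-cosh ⟩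
    C · (t · θ arcsinh)    ≈⟨ ≈-solve 3 (λ c t a → c :· (t :· a) :≈ t :· (c :· a)) ≈-refl C t (θ arcsinh) ⟩
    t · (C · θ arcsinh)    ≈⟨ ·-congˡ t cosh-·-θarcsinh ⟩
    t · t                  □

  -- The identity cosh² = 1 + sinh² at arcsinh t, obtained by comparing `θ` of both sides. The
  -- constant terms compute to 1, since in degree 0 a composition has only its term for k = 0.
  cosh² : C · C ≈ 𝟙 ⊕ t · t
  cosh² = θ-injective refl (begin-≈
    θ (C · C)              ≈⟨ θ-· C C ⟩
    θ C · C ⊕ C · θ C      ≈⟨ ⊕-congʳ (C · θ C) (·-comm (θ C) C) ⟩
    C · θ C ⊕ C · θ C      ≈⟨ ⊕-cong cosh-·-θcosh cosh-·-θcosh ⟩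
    t · t ⊕ t · t          ≈⟨ ⊕-cong (·-congʳ t θ-t) (·-congˡ t θ-t) ⟨
    θ t · t ⊕ t · θ t      ≈⟨ θ-· t t ⟨
    θ (t · t)              ≈⟨ (λ n → sym (+-identityˡ (θ (t · t) n))) ⟩
    𝟘 ⊕ θ (t · t)          ≈⟨ ⊕-congʳ (θ (t · t)) θ-𝟙 ⟨
    θ 𝟙 ⊕ θ (t · t)        ≈⟨ θ-⊕ 𝟙 (t · t) ⟨
    θ (𝟙 ⊕ t · t)          □)

  -- C² · θC equals (1 + t²) θC by `cosh²`, and equals t² C because C · θC = t².
  cosh-ODE : SatisfiesODE C
  cosh-ODE = begin-≈
    θ C ⊕ (t· (t· (θ C)))        ≈⟨ ⊕-congˡ (θ C) (t²-· (θ C)) ⟨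
    θ C ⊕ t · t · θ C            ≈⟨ ≈-solve 2 (λ x y → x :⊕ y :· x :≈ (:con 1 :⊕ y) :· x) ≈-refl (θ C) (t · t) ⟩
    (𝟙 ⊕ t · t) · θ C            ≈⟨ ·-congʳ (θ C) cosh² ⟨
    C · C · θ C                  ≈⟨ ≈-solve 2 (λ c x → c :· c :· x :≈ c :· x :· c) ≈-refl C (θ C) ⟩
    C · θ C · C                  ≈⟨ ·-congʳ C cosh-·-θcosh ⟩
    t · t · C                    ≈⟨ t²-· C ⟩
    (t· (t· C))                  □

  cosh≈√ : C ≈ even √-coefficient
  cosh≈√ = ODE-unique cosh-ODE √-ODE refl

  quotient-square : ∀ f → f · arcsinh ≈ t →
                    f · f ⊕ even √-coefficient · θ f ≈ even √-coefficient · f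
  quotient-square f f·a≈t = begin-≈
    f · f ⊕ even √-coefficient · θ f   ≈⟨ ⊕-congˡ (f · f) (·-congʳ (θ f) cosh≈√) ⟨
    f · f ⊕ C · θ f                    ≈⟨ ·t-cancel times-t ⟩
    C · f                              ≈⟨ ·-congʳ f cosh≈√ ⟩
    even √-coefficient · f             □
    where
    a = arcsinh

    -- The factor t is expanded as f a. One inner f a is then traded for C θa, both being t, so that
    -- C f splits off and leaves θ(f a) = θt = t.
    times-t : (f · f ⊕ C · θ f) · t ≈ C · f · t
    times-t = begin-≈
      (f · f ⊕ C · θ f) · t               ≈⟨ ·-congˡ (f · f ⊕ C · θ f) f·a≈t ⟨
      (f · f ⊕ C · θ f) · (f · a)
        ≈⟨ ≈-solve 4 (λ f a c x → (f :· f :⊕ c :· x) :· (f :· a) :≈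
             (f :· (f :· a) :⊕ c :· x :· a) :· f) ≈-refl f a C (θ f) ⟩
      (f · (f · a) ⊕ C · θ f · a) · f
        ≈⟨ ·-congʳ f (⊕-congʳ (C · θ f · a) (·-congˡ f (≈-trans f·a≈t (≈-sym cosh-·-θarcsinh)))) ⟩
      (f · (C · θ a) ⊕ C · θ f · a) · f
        ≈⟨ ≈-solve 5 (λ f a c x y → (f :· (c :· y) :⊕ c :· x :· a) :· f :≈
             c :· f :· (x :· a :⊕ f :· y)) ≈-refl f a C (θ f) (θ a) ⟩
      C · f · (θ f · a ⊕ f · θ a)         ≈⟨ ·-congˡ (C · f) (θ-· f a) ⟨
      C · f · θ (f · a)                   ≈⟨ ·-congˡ (C · f) (θ-cong f·a≈t) ⟩
      C · f · θ t                         ≈⟨ ·-congˡ (C · f) θ-t ⟩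
      C · f · t                           □

-- Comparison of coefficients

-- Any i < n leaves a positive remainder, which has no composition into zero parts.
∑Compositions-1 : ∀ n (f : Vec ℕ 1 → ℚ) → ∑Compositions 1 n f ≡ f (n ∷ [])
∑Compositions-1 n f = trans
  (∑-last n (λ i i<n → positive (n ∸ i) (ℕ.m<n⇒0<n∸m i<n)))
  (cong (λ m → ∑Compositions 0 m (λ is → f (n ∷ is))) (ℕ.n∸n≡0 n))
  where
  positive : ∀ m {g} → 0 ℕ.< m → ∑Compositions 0 m g ≡ 0ℚ
  positive (suc m) _ = refl

theorem2 : (c : ℕ → ℚ) → IsCauchyLevel2 c → (n : ℕ) →
    convolution c (0 ∷ 0 ∷ []) n ≡
    fromℕ ((2 ℕ.* n) !) *
    (∑[ l ≤ n ]
    (fromℤ (-1ℤ ℤ.^ (n ∸ l))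
    * (+ (2 ℕ.* n) ℤ.- + (2 ℕ.* l) ℤ.- + 3) !!
    * fromℤ (+ (2 ℕ.* l) ℤ.- + 1)
    ÷ (2 ℕ.^ (n ∸ l) ℕ.* (n ∸ l) ! ℕ.* (2 ℕ.* l) !))
    * c l)
theorem2 c (arcsinh , (a₀≡0 , sinh∘a≈t) , f·a≈t) n = begin
  convolution c (0 ∷ 0 ∷ []) n
    ≡⟨ ∑-cong n (λ i _ → convolution-term i) ⟩
  ∑≤ n (λ i → N * (u i * u (n ∸ i)))
    ≡⟨ *-distribˡ-∑ N n (λ i → u i * u (n ∸ i)) ⟨
  N * (u · u) n
    ≡⟨ cong (N *_) square ⟩
  N * ∑≤ n term
    ∎
  where
  N = fromℕ ((2 ℕ.* n) !)

  -- `even u` is t / arcsinh t, and `v` below lists the even coefficients of its image under `θ`.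
  u : ℕ → ℚ
  u k = c k ÷ (2 ℕ.* k) !

  v : ℕ → ℚ
  v k = fromℕ (2 ℕ.* k) * u k

  s : ℕ → ℚ
  s = √-coefficient

  term : ℕ → ℚ
  term l = (fromℤ (-1ℤ ℤ.^ (n ∸ l)) * (+ (2 ℕ.* n) ℤ.- + (2 ℕ.* l) ℤ.- + 3) !!
    * fromℤ (+ (2 ℕ.* l) ℤ.- + 1)
    ÷ (2 ℕ.^ (n ∸ l) ℕ.* (n ∸ l) ! ℕ.* (2 ℕ.* l) !)) * c l

  convolution-term : ∀ i →
    ∑Compositions 1 (n ∸ i) (λ is → (N ÷ ∏[2 (i ∷ is) ]!) * ∏-shifted c (0 ∷ 0 ∷ []) (i ∷ is))
      ≡ N * (u i * u (n ∸ i))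
  convolution-term i = begin
    ∑Compositions 1 j (λ is → (N ÷ ∏[2 (i ∷ is) ]!) * ∏-shifted c (0 ∷ 0 ∷ []) (i ∷ is))
      ≡⟨ ∑Compositions-1 j (λ is → (N ÷ ∏[2 (i ∷ is) ]!) * ∏-shifted c (0 ∷ 0 ∷ []) (i ∷ is)) ⟩
    (N ÷ ((2 ℕ.* i) ! ℕ.* ((2 ℕ.* j) ! ℕ.* 1))) * (c (i ℕ.+ 0) * (c (j ℕ.+ 0) * 1ℚ))
      ≡⟨ cong₂ (λ x y → x * (c y * (c (j ℕ.+ 0) * 1ℚ)))
           (÷-recip N ((2 ℕ.* i) ! ℕ.* ((2 ℕ.* j) ! ℕ.* 1))) (ℕ.+-identityʳ i) ⟩
    N * recip ((2 ℕ.* i) ! ℕ.* ((2 ℕ.* j) ! ℕ.* 1)) * (c i * (c (j ℕ.+ 0) * 1ℚ))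
      ≡⟨ cong₂ (λ x y → N * x * (c i * (c y * 1ℚ)))
           (trans (recip-* ((2 ℕ.* i) !) ((2 ℕ.* j) ! ℕ.* 1))
             (cong (λ m → p * recip m) (ℕ.*-identityʳ ((2 ℕ.* j) !)))) (ℕ.+-identityʳ j) ⟩
    N * (p * q) * (c i * (c j * 1ℚ))
      ≡⟨ solve 5 (λ N p q x y → N :* (p :* q) :* (x :* (y :* con 1ℚ)) := N :* ((x :* p) :* (y :* q)))
           refl N p q (c i) (c j) ⟩
    N * ((c i * p) * (c j * q))
      ≡⟨ cong₂ (λ x y → N * (x * y)) (÷-recip (c i) ((2 ℕ.* i) !)) (÷-recip (c j) ((2 ℕ.* j) !)) ⟨
    N * (u i * u j) ∎
    where
    j = n ∸ i
    p = recip ((2 ℕ.* i) !)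
    q = recip ((2 ℕ.* j) !)

  -- The sign in `√-coefficient` makes `term l` equal to (1 - 2l) u_l s_{n-l}; adding the summand 2l
  -- u_l s_{n-l} of `v · s` leaves u_l s_{n-l}.
  term-value : ∀ l → l ℕ.≤ n → term l + v l * s (n ∸ l) ≡ u l * s (n ∸ l)
  term-value l l≤n = begin
    term l + v l * s k
      ≡⟨ cong (λ x → x * c l + v l * s k) (÷-recip _ (2 ℕ.^ k ℕ.* k ! ℕ.* (2 ℕ.* l) !)) ⟩
    e * (+ (2 ℕ.* n) ℤ.- + (2 ℕ.* l) ℤ.- + 3) !! * fromℤ (+ (2 ℕ.* l) ℤ.- + 1)
      * recip (2 ℕ.^ k ℕ.* k ! ℕ.* (2 ℕ.* l) !) * c l + v l * s k
      ≡⟨ cong₂ (λ i y → e * (i ℤ.- + 3) !! * fromℤ (+ (2 ℕ.* l) ℤ.- + 1) * y * c l + v l * s k)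
           index (recip-* (2 ℕ.^ k ℕ.* k !) ((2 ℕ.* l) !)) ⟩
    e * d * fromℤ (+ (2 ℕ.* l) ℤ.- + 1) * (r * p) * c l + v l * s k
      ≡⟨ cong₂ (λ y z → e * d * y * (r * p) * c l + x * z * s k)
           (fromℤ-homo-+ (+ (2 ℕ.* l)) (ℤ.- + 1)) (÷-recip (c l) ((2 ℕ.* l) !)) ⟩
    e * d * (x + - 1ℚ) * (r * p) * c l + x * (c l * p) * - (e * d * r)
      ≡⟨ solve 6 (λ e d x r p c →
           e :* d :* (x :+ :- con 1ℚ) :* (r :* p) :* c :+ x :* (c :* p) :* :- (e :* d :* r)
             := c :* p :* :- (e :* d :* r)) refl e d x r p (c l) ⟩
    c l * p * s k
      ≡⟨ cong (_* s k) (÷-recip (c l) ((2 ℕ.* l) !)) ⟨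
    u l * s k ∎
    where
    k = n ∸ l
    e = fromℤ (-1ℤ ℤ.^ k)
    d = oddFactorial k
    x = fromℕ (2 ℕ.* l)
    r = recip (2 ℕ.^ k ℕ.* k !)
    p = recip ((2 ℕ.* l) !)

    -- Here l ≤ n turns the integer difference into 2(n - l), so that the double factorial of the
    -- statement becomes `oddFactorial k`.
    index : + (2 ℕ.* n) ℤ.- + (2 ℕ.* l) ≡ + (2 ℕ.* k)
    index = begin
      + (2 ℕ.* n) ℤ.- + (2 ℕ.* l)   ≡⟨ ℤ.m-n≡m⊖n (2 ℕ.* n) (2 ℕ.* l) ⟩
      2 ℕ.* n ℤ.⊖ 2 ℕ.* l           ≡⟨ ℤ.⊖-≥ (ℕ.*-monoʳ-≤ 2 l≤n) ⟩
      + (2 ℕ.* n ∸ 2 ℕ.* l)         ≡⟨ cong +_ (ℕ.*-distribˡ-∸ 2 n l) ⟨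
      + (2 ℕ.* (n ∸ l))             ∎

  even-square : even (u · u) ⊕ even (s · v) ≈ even (s · u)
  even-square = begin-≈
    even (u · u) ⊕ even (s · v)
      ≈⟨ ⊕-cong (even-· u u) (even-· s v) ⟨
    even u · even u ⊕ even s · even v
      ≈⟨ ⊕-congˡ (even u · even u) (·-congˡ (even s) (even-weight fromℕ u)) ⟨
    even u · even u ⊕ even s · θ (even u)
      ≈⟨ quotient-square a₀≡0 sinh∘a≈t (even u) f·a≈t ⟩
    even s · even u
      ≈⟨ even-· s u ⟩
    even (s · u) □

  square : (u · u) n ≡ ∑≤ n term
  -- Adding the coefficient of C θf to both sides makes the claim the coefficient of t²ⁿ in f² + C
  -- θf = C f.
  square = +-cancelʳ ((v · s) n) (begin
    (u · u) n + (v · s) n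
      ≡⟨ cong (_+_ ((u · u) n)) (·-comm v s n) ⟩
    (u · u) n + (s · v) n
      ≡⟨ cong₂ _+_ (even-double (u · u) n) (even-double (s · v) n) ⟨
    even (u · u) (2 ℕ.* n) + even (s · v) (2 ℕ.* n)
      ≡⟨ even-square (2 ℕ.* n) ⟩
    even (s · u) (2 ℕ.* n)
      ≡⟨ even-double (s · u) n ⟩
    (s · u) n
      ≡⟨ ·-comm s u n ⟩
    (u · s) n
      ≡⟨ ∑-cong n term-value ⟨
    ∑≤ n (λ l → term l + v l * s (n ∸ l))
      ≡⟨ ∑-distrib-+ n term (λ l → v l * s (n ∸ l)) ⟩
    ∑≤ n term + (v · s) n ∎)
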